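{- Let $(\Sigma,\oplus,e,|\cdot|,\mathsf{stable})$ be a separation algebra, let $A$ be an assertion and $B$ a well-formed assertion, and let $S_A=\{\sigma_A\in\Sigma\mid\sigma_A\models A\}$. Let $\sigma,\sigma',\sigma_w\in\Sigma$. If $\sigma_w$ is a stable footprint of $A\mathbin{ -\!\!*}B$ (i.e. $\mathsf{stable}(\sigma_w)$ holds and $\sigma_w$ is a footprint of $A\mathbin{ -\!\!*}B$) and $\sigma=\sigma'\oplus\sigma_w$, then there exists a witness set $S'\subseteq\Sigma\times\Sigma$ such that $$\vdash \langle B,\ \lambda\_.\,\top,\ (\sigma,\{(\sigma_A,e)\mid \sigma_A\in S_A\})\rangle \rightsquigarrow (\sigma',S')$$ is derivable in the package logic.
   Context: **Separation algebra.** A separation algebra is a quintuple $(\Sigma,\oplus,e,|\cdot|,\mathsf{stable})$ where $\Sigma$ is a set of states; $\oplus$ is a partial binary operation on $\Sigma$ that is commutative and associative (in the sense of partial commutative monoids: one side is defined iff the other is, and then they are equal) with neutral element $e\in\Sigma$; $|\cdot|:\Sigma\to\Sigma$ (the core) is a total function; $\mathsf{stable}$ is a predicate on $\Sigma$; and the following axioms hold (an equation $c=a\oplus b$ includes the assertion that $a\oplus b$ is defined), for all states: (a) $x=x\oplus|x|$ and $|x|=|x|\oplus|x|$; (b) if $x=x\oplus c$ then there is $r\in\Sigma$ with $|x|=c\oplus r$; (c) if $c=a\oplus b$ then $|c|=|a|\oplus|b|$; (d) $\mathsf{stable}(e)$, and if $c=a\oplus b$, $\mathsf{stable}(a)$ and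 $\mathsf{stable}(b)$, then $\mathsf{stable}(c)$; (e) if $c=a\oplus b$ and $c=c\oplus c$ then $a=a\oplus a$; (f) if $a=b\oplus x$, $a=b\oplus y$ and $|x|=|y|$, then $x=y$. Write $\sigma_1\#\sigma_2$ iff $\sigma_1\oplus\sigma_2$ is defined, and $\sigma_2\succeq\sigma_1$ iff there is $\sigma_r$ with $\sigma_2=\sigma_1\oplus\sigma_r$. If $\sigma_2\succeq\sigma_1$, then $\sigma_2\ominus\sigma_1$ denotes the $\succeq$-largest state $\sigma_r$ with $\sigma_2=\sigma_1\oplus\sigma_r$. A state $\sigma$ is pure iff $\sigma=\sigma\oplus\sigma$. **Assertions.** A semantic assertion is a function $\mathcal B:\Sigma\to\{\top,\bot\}$. Assertions are given by the grammar $A ::= A*A\mid \mathcal B\Rightarrow A\mid \mathcal B$, where the left-hand side $\mathcal B$ of an implication is a semantic assertion. Satisfaction: $\sigma\models A_1*A_2$ iff there are $\sigma_1,\sigma_2$ with $\sigma=\sigma_1\oplus\sigma_2$, $\sigma_1\models A_1$, $\sigma_2\models A_2$; $\sigma\models\mathcal B\Rightarrow A$ iff ($\mathcal B(\sigma)$ implies $\sigma\models A$); $\sigma\models\mathcal B$ iff $\mathcal B(\sigma)$. **Well-formedness.** $\mathit{monoPure}(\mathcal B)$ holds iff for all $\sigma,\sigma_p\in\Sigma$ with $\sigma_p$ pure, $\mathcal B(\sigma)$ and $\sigma\#\sigma_p$, we have $\mathcal B(\sigma\oplus\sigma_p)$. Well-formedness $\mathit{wf}$ of assertions: $\mathit{wf}(A_1*A_2)$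 iff $\mathit{wf}(A_1)$ and $\mathit{wf}(A_2)$; $\mathit{wf}(\mathcal B\Rightarrow A)$ iff $\mathcal B$ is pure (i.e. $\mathcal B(\sigma)\Leftrightarrow\mathcal B(|\sigma|)$ for all $\sigma$), $\mathit{monoPure}(\lnot\mathcal B)$ and $\mathit{wf}(A)$; $\mathit{wf}(\mathcal B)$ iff $\mathit{monoPure}(\mathcal B)$. **Footprint.** A state $\sigma_w$ is a footprint of $A\mathbin{ -\!\!*}B$ iff for all $\sigma_A\in\Sigma$ with $\sigma_A\models A$ and $\sigma_A\#\sigma_w$, $\sigma_A\oplus\sigma_w\models B$. **Package logic.** A witness set is a set of pairs $(\sigma_A,\sigma_B)$ of states. A context $\Delta$ is a pair $(\sigma,S)$ of a state and a witness set. A path condition $pc$ is a function $\Sigma\to\{\top,\bot\}$. A configuration is a triple $\langle B,pc,\Delta\rangle$ with $B$ an assertion. The judgement $\vdash\langle B,pc,\Delta\rangle\rightsquigarrow\Delta'$ is inductively defined by the four rules below ($(\sigma_A\oplus\sigma_B)\#\sigma_w$ means that $\sigma_A\oplus\sigma_B$ is defined and compatible with $\sigma_w$; the states written with $\oplus$ in the new witness sets are understood to be defined, which is always the case when derivations start from witness sets all of whose pairs have compatible components, such as those with second component $e$). - *Implication*: from $\langle A,\lambda\sigma.\,pc(\sigma)\land b(\sigma),\Delta\rangle\rightsquigarrow\Delta'$ infer $\langle b\Rightarrow A,pc,\Delta\rangle\rightsquigarrow\Delta'$. - *Star*: from $\langle A_1,pc,\Delta_0\rangle\rightsquigarrow\Delta_1$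 and $\langle A_2,pc,\Delta_1\rangle\rightsquigarrow\Delta_2$ infer $\langle A_1*A_2,pc,\Delta_0\rangle\rightsquigarrow\Delta_2$. - *Atom*: let $\mathit{choice}:\Sigma\times\Sigma\to\Sigma$ be any function such that for all $(\sigma_A,\sigma_B)\in S$ with $pc(\sigma_A)$, $\sigma_A\succeq\mathit{choice}(\sigma_A,\sigma_B)$ and $\mathcal B(\mathit{choice}(\sigma_A,\sigma_B))$. Let $S_\top=\{(\sigma_A\ominus\mathit{choice}(\sigma_A,\sigma_B),\ \sigma_B\oplus\mathit{choice}(\sigma_A,\sigma_B))\mid(\sigma_A,\sigma_B)\in S\land pc(\sigma_A)\}$ and $S_\bot=\{(\sigma_A,\sigma_B)\mid(\sigma_A,\sigma_B)\in S\land\lnot pc(\sigma_A)\}$. Infer $\langle\mathcal B,pc,(\sigma,S)\rangle\rightsquigarrow(\sigma,S_\top\cup S_\bot)$. - *Extract*: from $\sigma_0=\sigma_1\oplus\sigma_w$, $\mathsf{stable}(\sigma_w)$, $S_1=\{(\sigma_A\oplus\sigma_w,\sigma_B)\mid(\sigma_A,\sigma_B)\in S_0\land(\sigma_A\oplus\sigma_B)\#\sigma_w\}$ and $\langle A,pc,(\sigma_1,S_1)\rangle\rightsquigarrow\Delta$ infer $\langle A,pc,(\sigma_0,S_0)\rangle\rightsquigarrow\Delta$. -}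

module Defs where

open import Data.Bool.Base using (Bool; T; not; _∧_)
open import Data.Maybe.Base using (Maybe; just; _>>=_)
open import Data.Product.Base using (_×_; _,_; ∃; ∃-syntax; ∃₂)
open import Function.Base using (_∘_)
open import Function.Bundles using (_⇔_)
open import Level using (Level; Lift; suc; _⊔_)
open import Relation.Binary.Core using (Rel)
open import Relation.Binary.PropositionalEquality.Core using (_≡_)
open import Relation.Nullary.Negation.Core using (¬_)
open import Relation.Unary using (Pred; _∪_)

-- The partial operation is Maybe-valued, so `a ⊕ b ≡ just c` says that a ⊕ b
-- is defined and equal to c, and ≡ between Maybe values says that both sides
-- are undefined, or both are defined and equal.

record SeparationAlgebra (a p : Level) : Set (suc (a ⊔ p)) where
  infixl 6 _⊕_
  field
    State  : Set a
    _⊕_    : State → State → Maybe State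
    e      : State
    ∣_∣    : State → State
    Stable : Pred State p

    ⊕-comm      : ∀ x y → x ⊕ y ≡ y ⊕ x
    ⊕-assoc     : ∀ x y z → (x ⊕ y >>= λ xy → xy ⊕ z) ≡ (y ⊕ z >>= λ yz → x ⊕ yz)
    ⊕-identityʳ : ∀ x → x ⊕ e ≡ just x

    core-absorb : ∀ x → x ⊕ ∣ x ∣ ≡ just x
    core-pure   : ∀ x → ∣ x ∣ ⊕ ∣ x ∣ ≡ just ∣ x ∣
    core-max    : ∀ x c → x ⊕ c ≡ just x → ∃[ r ] c ⊕ r ≡ just ∣ x ∣
    core-⊕      : ∀ a b c → a ⊕ b ≡ just c → ∣ a ∣ ⊕ ∣ b ∣ ≡ just ∣ c ∣
    stable-e    : Stable e
    stable-⊕    : ∀ a b c → a ⊕ b ≡ just c → Stable a → Stable b → Stable c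
    pure-split  : ∀ a b c → a ⊕ b ≡ just c → c ⊕ c ≡ just c → a ⊕ a ≡ just a
    ⊕-cancelˡ   : ∀ a b x y → b ⊕ x ≡ just a → b ⊕ y ≡ just a → ∣ x ∣ ≡ ∣ y ∣ → x ≡ y

module PackageLogic {a p : Level} (Σ-alg : SeparationAlgebra a p) where
  open SeparationAlgebra Σ-alg

  infix 4 _#_ _⪰_ _⊨_
  infixr 6 _✴_
  infixr 5 _⇛_

  _#_ : Rel State a
  σ₁ # σ₂ = ∃[ σ ] σ₁ ⊕ σ₂ ≡ just σ

  _⪰_ : Rel State a
  σ₂ ⪰ σ₁ = ∃[ r ] σ₁ ⊕ r ≡ just σ₂

  -- The graph of ⊖: `IsDifference σ₂ σ₁ d` reads d = σ₂ ⊖ σ₁.  The axioms make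
  -- ⪰ antisymmetric, so d is unique, and if σ₁ ⊕ r ≡ just σ₂ then
  -- r ⊕ ∣ σ₂ ∣ is defined and is such a d.
  IsDifference : State → State → Pred State a
  IsDifference σ₂ σ₁ d =
    σ₁ ⊕ d ≡ just σ₂ × (∀ r → σ₁ ⊕ r ≡ just σ₂ → d ⪰ r)

  PureState : Pred State a
  PureState σ = σ ⊕ σ ≡ just σ

  SemAssertion : Set a
  SemAssertion = State → Bool

  data Assertion : Set a where
    _✴_ : Assertion → Assertion → Assertion
    _⇛_ : SemAssertion → Assertion → Assertion
    sem : SemAssertion → Assertion

  _⊨_ : State → Assertion → Set a
  σ ⊨ (A₁ ✴ A₂) = ∃₂ λ σ₁ σ₂ → σ₁ ⊕ σ₂ ≡ just σ × σ₁ ⊨ A₁ × σ₂ ⊨ A₂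
  σ ⊨ (b ⇛ A)   = T (b σ) → σ ⊨ A
  σ ⊨ sem b     = Lift a (T (b σ))

  MonoPure : SemAssertion → Set a
  MonoPure b = ∀ σ σₚ τ → PureState σₚ → T (b σ) → σ ⊕ σₚ ≡ just τ → T (b τ)

  PureAssertion : SemAssertion → Set a
  PureAssertion b = ∀ σ → T (b σ) ⇔ T (b ∣ σ ∣)

  WellFormed : Assertion → Set a
  WellFormed (A₁ ✴ A₂) = WellFormed A₁ × WellFormed A₂
  WellFormed (b ⇛ A)   = PureAssertion b × MonoPure (not ∘ b) × WellFormed A
  WellFormed (sem b)   = MonoPure b

  IsFootprint : State → Assertion → Assertion → Set a
  IsFootprint σw A B = ∀ σA τ → σA ⊨ A → σA ⊕ σw ≡ just τ → τ ⊨ B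

  WitnessSet : Set (suc a)
  WitnessSet = Pred (State × State) a

  Context : Set (suc a)
  Context = State × WitnessSet

  PathCondition : Set a
  PathCondition = State → Bool

  ValidChoice : SemAssertion → PathCondition → WitnessSet → (State × State → State) → Set a
  ValidChoice b pc S choice = ∀ σA σB → S (σA , σB) → T (pc σA) →
    σA ⪰ choice (σA , σB) × T (b (choice (σA , σB)))

  S⊤ : PathCondition → WitnessSet → (State × State → State) → WitnessSet
  S⊤ pc S choice (τA , τB) = ∃₂ λ σA σB →
    S (σA , σB) × T (pc σA) ×
    IsDifference σA (choice (σA , σB)) τA ×
    σB ⊕ choice (σA , σB) ≡ just τB

  S⊥ : PathCondition → WitnessSet → WitnessSet
  S⊥ pc S (σA , σB) = S (σA , σB) × ¬ T (pc σA)

  extended : State → WitnessSet → WitnessSet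
  extended σw S (τA , σB) = ∃ λ σA →
    S (σA , σB) ×
    (∃[ σAB ] σA ⊕ σB ≡ just σAB × σAB # σw) ×
    σA ⊕ σw ≡ just τA

  infix 3 ⊢⟨_,_,_⟩⇝_

  data ⊢⟨_,_,_⟩⇝_ : Assertion → PathCondition → Context → Context → Set (suc a ⊔ p) where
    implication : ∀ {b A pc Δ Δ′} →
      ⊢⟨ A , (λ σ → pc σ ∧ b σ) , Δ ⟩⇝ Δ′ →
      ⊢⟨ b ⇛ A , pc , Δ ⟩⇝ Δ′

    star : ∀ {A₁ A₂ pc Δ₀ Δ₁ Δ₂} →
      ⊢⟨ A₁ , pc , Δ₀ ⟩⇝ Δ₁ →
      ⊢⟨ A₂ , pc , Δ₁ ⟩⇝ Δ₂ →
      ⊢⟨ A₁ ✴ A₂ , pc , Δ₀ ⟩⇝ Δ₂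

    atom : ∀ {b pc σ S} (choice : State × State → State) →
      ValidChoice b pc S choice →
      ⊢⟨ sem b , pc , (σ , S) ⟩⇝ (σ , S⊤ pc S choice ∪ S⊥ pc S)

    extract : ∀ {A pc σ₀ σ₁ σw S₀ Δ} →
      σ₁ ⊕ σw ≡ just σ₀ →
      Stable σw →
      ⊢⟨ A , pc , (σ₁ , extended σw S₀) ⟩⇝ Δ →
      ⊢⟨ A , pc , (σ₀ , S₀) ⟩⇝ Δ

{-# OPTIONS --safe #-}

-- Extract σw first: by the footprint property, the first component of every
-- witness then satisfies B.  The rest is an induction on B that mirrors a
-- weakest precondition: each witness state splits as σ₁ ⊕ r with σ₁ ⊨ B and
-- r ∈ Q, where the upward closed Q describes what the continuation still needs
-- ("contains a part satisfying A₂" when A₁ of A₁ ✴ A₂ is processed, everything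
-- at the end).  Without Q the left conjunct could consume a part of the state
-- that A₂ needs.  Excluded middle turns the split into the choice of `atom`.

module Submission where

open import Defs
open import Axiom.ExcludedMiddle using (ExcludedMiddle)
open import Data.Bool.Base using (true; false; T; not; _∧_)
open import Data.Bool.Properties using (T-∧; T?)
open import Data.Empty using (⊥-elim)
open import Data.Maybe.Base using (Maybe; just; _>>=_)
open import Data.Maybe.Properties using (just-injective)
open import Data.Product.Base using (∃; ∃-syntax; ∃₂; _×_; _,_)
open import Data.Sum.Base using (_⊎_; inj₁; inj₂)
open import Data.Unit.Polymorphic.Base using (⊤)
open import Function.Base using (_∘_)
open import Function.Bundles using (mk⇔; module Equivalence)
open import Level using (Level; lift)
open import Relation.Binary.PropositionalEquality.Core using (_≡_; refl; sym; trans; cong; subst)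
open import Relation.Nullary.Decidable.Core using (Dec; yes; no)
open import Relation.Nullary.Negation.Core using (¬_)
open import Relation.Unary using (Pred; _∈_; ｛_｝; _⟨×⟩_)

open Equivalence using (to; from)

>>=-just⁻ : ∀ {a b} {A : Set a} {B : Set b} (m : Maybe A) {f : A → Maybe B} {y} →
  (m >>= f) ≡ just y → ∃[ x ] m ≡ just x × f x ≡ just y
>>=-just⁻ (just x) eq = x , refl , eq

module _ {a p : Level} (Σ-alg : SeparationAlgebra a p) where
  open SeparationAlgebra Σ-alg
  open PackageLogic Σ-alg

  ⊕-assocʳ : ∀ {x y z u w} → x ⊕ y ≡ just u → u ⊕ z ≡ just w →
    ∃[ v ] y ⊕ z ≡ just v × x ⊕ v ≡ just w
  ⊕-assocʳ {x} {y} {z} xy≡u uz≡w = >>=-just⁻ (y ⊕ z)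
    (trans (sym (⊕-assoc x y z)) (trans (cong (_>>= (_⊕ z)) xy≡u) uz≡w))

  ⊕-assocˡ : ∀ {x y z v w} → y ⊕ z ≡ just v → x ⊕ v ≡ just w →
    ∃[ u ] x ⊕ y ≡ just u × u ⊕ z ≡ just w
  ⊕-assocˡ {x} {y} {z} yz≡v xv≡w = >>=-just⁻ (x ⊕ y)
    (trans (⊕-assoc x y z) (trans (cong (_>>= (x ⊕_)) yz≡v) xv≡w))

  ⊕-absorb : ∀ {b c} → PureState b → c ⪰ b → b ⊕ c ≡ just c
  ⊕-absorb bb≡b (r , br≡c) with ⊕-assocʳ bb≡b br≡c
  ... | v , br≡v , bv≡c with just-injective (trans (sym br≡v) br≡c)
  ... | refl = bv≡c

  ⪰-trans : ∀ {x y z} → x ⪰ y → y ⪰ z → x ⪰ z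
  ⪰-trans (r , yr≡x) (s , zs≡y) with ⊕-assocʳ zs≡y yr≡x
  ... | t , _ , zt≡x = t , zt≡x

  -- From `y ⊕ s = x` and `x ⊕ b = y`, `x` absorbs `b ⊕ s`, so `core-max` puts `b ⊕ s` below
  -- `∣ x ∣`. Being part of a pure state, `b` is pure, hence absorbed by `∣ x ∣` and so by `x`.
  ⪰-antisym : ∀ {x y} → x ⪰ y → y ⪰ x → x ≡ y
  ⪰-antisym {x} (s , ys≡x) (b , xb≡y)
    with ⊕-assocʳ xb≡y ys≡x
  ... | bs , bs≡ , xbs≡x with core-max x bs xbs≡x
  ... | r , bsr≡∣x∣ with ⊕-assocʳ bs≡ bsr≡∣x∣
  ... | sr , _ , bsr′≡∣x∣
    with ⊕-assocˡ (trans (⊕-comm ∣ x ∣ b) b∣x∣≡∣x∣) (core-absorb x)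
    where
    b∣x∣≡∣x∣ : b ⊕ ∣ x ∣ ≡ just ∣ x ∣
    b∣x∣≡∣x∣ = ⊕-absorb (pure-split b sr ∣ x ∣ bsr′≡∣x∣ (core-pure x)) (sr , bsr′≡∣x∣)
  ... | u , x∣x∣≡u , ub≡x with just-injective (trans (sym x∣x∣≡u) (core-absorb x))
  ... | refl = just-injective (trans (sym ub≡x) xb≡y)

  core-mono : ∀ {x y} → x ⪰ y → ∣ x ∣ ⪰ ∣ y ∣
  core-mono {x} {y} (r , yr≡x) = ∣ r ∣ , core-⊕ y r x yr≡x

  -- Since `σ` absorbs its core, `d ⊕ ∣ σ ∣` also completes `c` to `σ`, and `d` is the largest such
  -- state.
  difference-⪰-core : ∀ {σ c d} → IsDifference σ c d → d ⪰ ∣ σ ∣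
  difference-⪰-core {σ} (cd≡σ , largest) with ⊕-assocʳ cd≡σ (core-absorb σ)
  ... | v , d∣σ∣≡v , cv≡σ =
    ⪰-trans (largest v cv≡σ) (_ , trans (⊕-comm _ _) d∣σ∣≡v)

  -- This is why a pure path condition keeps its value when `atom` subtracts the chosen state from a
  -- witness.
  difference-core : ∀ {σ c d} → IsDifference σ c d → ∣ d ∣ ≡ ∣ σ ∣
  difference-core {σ} diff@(cd≡σ , _) = ⪰-antisym
    (⪰-trans (core-mono (difference-⪰-core diff)) (core-max (∣ σ ∣) (∣ σ ∣) (core-pure σ)))
    (core-mono (_ , trans (⊕-comm _ _) cd≡σ))

  UpwardClosed : Pred State a → Set a
  UpwardClosed Q = ∀ {x y} → y ⪰ x → x ∈ Q → y ∈ Q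

  Splits : Assertion → Pred State a → Pred State a
  Splits B Q σ = ∃₂ λ σ₁ r → σ₁ ⊕ r ≡ just σ × σ₁ ⊨ B × r ∈ Q

  -- Extra state joins the remainder `r`; the part satisfying `B` stays fixed, so `B` may fail to be
  -- monotone.
  Splits-upward : ∀ B {Q} → UpwardClosed Q → UpwardClosed (Splits B Q)
  Splits-upward B up (s , xs≡y) (σ₁ , r , σ₁r≡x , σ₁⊨B , r∈Q)
    with ⊕-assocʳ σ₁r≡x xs≡y
  ... | r′ , rs≡r′ , σ₁r′≡y = σ₁ , r′ , σ₁r′≡y , σ₁⊨B , up (s , rs≡r′) r∈Q

  Splits-✴ : ∀ A₁ A₂ {Q σ} → Splits (A₁ ✴ A₂) Q σ → Splits A₁ (Splits A₂ Q) σ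
  Splits-✴ A₁ A₂ (_ , r , eq , (σ₁ , σ₂ , σ₁σ₂≡ , σ₁⊨A₁ , σ₂⊨A₂) , r∈Q)
    with ⊕-assocʳ σ₁σ₂≡ eq
  ... | s , σ₂r≡s , σ₁s≡σ = σ₁ , s , σ₁s≡σ , σ₁⊨A₁ , σ₂ , r , σ₂r≡s , σ₂⊨A₂ , r∈Q

  pure-resp-core : ∀ {b σ τ} → PureAssertion b → ∣ σ ∣ ≡ ∣ τ ∣ → T (b σ) → T (b τ)
  pure-resp-core {b} {σ} {τ} pure-b eq bσ =
    from (pure-b τ) (subst (T ∘ b) eq (to (pure-b σ) bσ))

  pure-∧ : ∀ {b c} → PureAssertion b → PureAssertion c → PureAssertion (λ σ → b σ ∧ c σ)
  pure-∧ pure-b pure-c σ = mk⇔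
    (λ h → let bσ , cσ = to T-∧ h in from T-∧ (to (pure-b σ) bσ , to (pure-c σ) cσ))
    (λ h → let bσ , cσ = to T-∧ h in from T-∧ (from (pure-b σ) bσ , from (pure-c σ) cσ))

  not-not⇒T : ∀ x → ¬ T (not x) → T x
  not-not⇒T true  _ = _
  not-not⇒T false h = h _

  not⇒¬T : ∀ x → T (not x) → ¬ T x
  not⇒¬T false _ ()

  -- By purity only cores matter. Adding the pure state `∣ τ ∣` to `∣ σ ∣` yields `∣ τ ∣`, so a
  -- failure of `b` at `∣ σ ∣` would persist at `∣ τ ∣`.
  pure-antitone : ∀ {b σ τ} → PureAssertion b → MonoPure (not ∘ b) →
    τ ⪰ σ → T (b τ) → T (b σ)
  pure-antitone {b} {σ} {τ} pure-b mono τ⪰σ bτ =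
    from (pure-b σ) (not-not⇒T (b ∣ σ ∣) λ ¬b∣σ∣ →
      not⇒¬T (b ∣ τ ∣)
        (mono (∣ σ ∣) (∣ τ ∣) (∣ τ ∣) (core-pure τ) ¬b∣σ∣ (⊕-absorb (core-pure σ) (core-mono τ⪰σ)))
        (to (pure-b τ) bτ))

  splitOr : ∀ {B Q σ} → Dec (Splits B Q σ) → State
  splitOr (yes (σ₁ , _)) = σ₁
  -- An arbitrary default: wherever `ValidChoice` constrains the choice, a split exists.
  splitOr (no _)         = e

  -- Recording that `pc` still holds at `τA` separates the two cases by the value of `pc`, so runs
  -- over the two conjuncts of `✴` act on the same witnesses.
  Processed : PathCondition → Pred State a → WitnessSet → WitnessSet
  Processed pc Q S (τA , τB) = (T (pc τA) × τA ∈ Q) ⊎ ((τA , τB) ∈ S × ¬ T (pc τA))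

  package : ExcludedMiddle a → ∀ B → WellFormed B →
    ∀ pc → PureAssertion pc → ∀ {Q} → UpwardClosed Q → ∀ σ S →
    (∀ {σA σB} → (σA , σB) ∈ S → T (pc σA) → Splits B Q σA) →
    ∃[ S′ ] (⊢⟨ B , pc , (σ , S) ⟩⇝ (σ , S′)) ×
            (∀ {τA τB} → (τA , τB) ∈ S′ → Processed pc Q S (τA , τB))
  package em (A₁ ✴ A₂) (wf₁ , wf₂) pc pure-pc {Q} up σ S splits =
    let S₁ , ⊢A₁ , post₁ = package em A₁ wf₁ pc pure-pc (Splits-upward A₂ up) σ S
          (λ ∈S h → Splits-✴ A₁ A₂ (splits ∈S h))
        S₂ , ⊢A₂ , post₂ = package em A₂ wf₂ pc pure-pc up σ S₁ (splits₂ post₁)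
    in S₂ , star ⊢A₁ ⊢A₂ , post post₁ ∘ post₂
    where
    splits₂ : ∀ {S₁ : WitnessSet} →
      (∀ {τA τB} → (τA , τB) ∈ S₁ → Processed pc (Splits A₂ Q) S (τA , τB)) →
      ∀ {σA σB} → (σA , σB) ∈ S₁ → T (pc σA) → Splits A₂ Q σA
    splits₂ post₁ ∈S₁ pcσA with post₁ ∈S₁
    ... | inj₁ (_ , split) = split
    ... | inj₂ (_ , ¬pcσA) = ⊥-elim (¬pcσA pcσA)

    post : ∀ {S₁ : WitnessSet} →
      (∀ {τA τB} → (τA , τB) ∈ S₁ → Processed pc (Splits A₂ Q) S (τA , τB)) →
      ∀ {τA τB} → Processed pc Q S₁ (τA , τB) → Processed pc Q S (τA , τB)
    post post₁ (inj₁ done) = inj₁ done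
    post post₁ (inj₂ (∈S₁ , ¬pcτA)) with post₁ ∈S₁
    ... | inj₁ (pcτA , _) = ⊥-elim (¬pcτA pcτA)
    ... | inj₂ untouched  = inj₂ untouched
  package em (b ⇛ A) (pure-b , mono , wf) pc pure-pc {Q} up σ S splits =
    let S′ , ⊢A , post′ = package em A wf (λ σ → pc σ ∧ b σ) (pure-∧ pure-pc pure-b) up σ S inner
    in S′ , implication ⊢A , post ∘ post′
    where
    inner : ∀ {σA σB} → (σA , σB) ∈ S → T (pc σA ∧ b σA) → Splits A Q σA
    inner ∈S h =
      let pcσA , bσA = to T-∧ h
          σ₁ , r , eq , σ₁⊨b⇛A , r∈Q = splits ∈S pcσA
      -- The path condition tests `b` at `σA`, whereas the implication is discharged at the smaller
      -- state `σ₁`.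
      in σ₁ , r , eq , σ₁⊨b⇛A (pure-antitone pure-b mono (r , eq) bσA) , r∈Q

    post : ∀ {τA τB} → Processed (λ σ → pc σ ∧ b σ) Q S (τA , τB) → Processed pc Q S (τA , τB)
    post (inj₁ (h , τA∈Q)) = let pcτA , _ = to T-∧ h in inj₁ (pcτA , τA∈Q)
    post {τA} (inj₂ (∈S , _)) with T? (pc τA)
    ... | no ¬pcτA = inj₂ (∈S , ¬pcτA)
    -- Here `b` fails at `τA`, so the pair kept its whole state, which lies above `r`.
    ... | yes pcτA =
      let σ₁ , r , eq , _ , r∈Q = splits ∈S pcτA
      in inj₁ (pcτA , up (σ₁ , trans (⊕-comm r σ₁) eq) r∈Q)
  package em (sem b) _ pc pure-pc {Q} up σ S splits = _ , atom choice valid , post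
    where
    choice : State × State → State
    choice (σA , _) = splitOr (em {Splits (sem b) Q σA})

    choice-splits : ∀ {σA σB} → (σA , σB) ∈ S → T (pc σA) →
      ∃[ r ] choice (σA , σB) ⊕ r ≡ just σA × T (b (choice (σA , σB))) × r ∈ Q
    choice-splits {σA} ∈S pcσA with em {Splits (sem b) Q σA}
    ... | yes (σ₁ , r , eq , lift bσ₁ , r∈Q) = r , eq , bσ₁ , r∈Q
    ... | no ¬split = ⊥-elim (¬split (splits ∈S pcσA))

    valid : ValidChoice b pc S choice
    valid σA σB ∈S pcσA =
      let r , eq , bc , _ = choice-splits ∈S pcσA in (r , eq) , bc

    post : ∀ {τA τB} → (S⊤ pc S choice (τA , τB) ⊎ S⊥ pc S (τA , τB)) →
      Processed pc Q S (τA , τB)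
    post (inj₂ untouched) = inj₂ untouched
    post (inj₁ (σA , σB , ∈S , pcσA , diff@(_ , largest) , _)) =
      let r , eq , _ , r∈Q = choice-splits ∈S pcσA
      -- `τA` is the largest complement of the chosen state, hence above the complement `r` of the
      -- split.
      in inj₁ (pure-resp-core pure-pc (sym (difference-core diff)) pcσA , up (largest r eq) r∈Q)

theorem2 : ∀ {a p} → ExcludedMiddle a →
    (Σ-alg : SeparationAlgebra a p) →
    let open SeparationAlgebra Σ-alg
        open PackageLogic Σ-alg
    in
    (A B : Assertion) → WellFormed B →
    (σ σ′ σw : State) →
    Stable σw → IsFootprint σw A B →
    σ′ ⊕ σw ≡ just σ →
    ∃ λ (S′ : WitnessSet) →
      ⊢⟨ B , (λ _ → true) , (σ , ((_⊨ A) ⟨×⟩ ｛ e ｝)) ⟩⇝ (σ′ , S′)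
theorem2 em Σ-alg A B wf σ σ′ σw stable footprint σ′σw≡σ =
  let S′ , ⊢B , _ = package Σ-alg em B wf (λ _ → true) (λ _ → mk⇔ _ _) {λ _ → ⊤} (λ _ _ → _)
        σ′ (extended σw ((_⊨ A) ⟨×⟩ ｛ e ｝))
        λ { {τA} (σA , (σA⊨A , _) , _ , eq) _ →
              -- The whole of `σA ⊕ σw` satisfies `B`, leaving the remainder `e`.
              τA , e , ⊕-identityʳ τA , footprint σA τA σA⊨A eq , _ }
  in S′ , extract σ′σw≡σ stable ⊢B
  where
  open SeparationAlgebra Σ-alg
  open PackageLogic Σ-alg
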